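{- Let $\vec d=(\vec a,\vec b)$ be a bidegree sequence of length $n$ with $\sum_i a_i=\sum_i b_i=n\bar c$ and $m:=\min\vec d\le n-1$. Define $k_*=m+1+\sqrt{(m+1)^2+n(\bar c-2m)}$, and let $k=\lceil k_*\rceil$ if $(m+1)^2+n(\bar c-2m)\ge0$ (i.e. $k_*$ is real) and $k=1$ otherwise. If $$\max\vec d\le\min\Big(\Big\lfloor n\frac{\bar c-m}{k}+m\Big\rfloor,\ n-1\Big),$$ then $\vec d$ is graphic.
   Context: A bidegree sequence of length $n$ is a pair $\vec d=(\vec a,\vec b)$ with $\vec a=(a_1,\dots,a_n)\in\mathbb{N}_0^n$ and $\vec b=(b_1,\dots,b_n)\in\mathbb{N}_0^n$. It is graphic with loops if there is an $n\times n$ matrix with entries in $\{0,1\}$ whose $i$th row sum is $a_i$ and whose $i$th column sum is $b_i$ for every $i\in[1..n]$; it is graphic if such a matrix exists with all diagonal entries equal to $0$. $\max\vec d$ and $\min\vec d$ denote the maximum and minimum over all $2n$ entries $a_1,\dots,a_n,b_1,\dots,b_n$. The number $\bar c$ (the average degree) is defined by $\sum_i a_i=\sum_i b_i=n\bar c$. -}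

module Defs where

open import Algebra.Properties.CommutativeMonoid.Sum
  using () renaming (sum to monoidSum)
open import Data.Fin.Base using (Fin; zero; toℕ)
open import Data.Integer.Base as ℤ using (ℤ; +_; -[1+_]; +≤+)
import Data.Integer.Properties as ℤ
open import Data.Nat.Base as ℕ using (ℕ; zero; suc; z≤n; s≤s)
import Data.Nat.Properties as ℕ
open import Data.Product using (_×_; _,_; ∃; map₂)
open import Data.Rational.Base
open import Data.Rational.Literals using (fromℤ)
open import Data.Rational.Properties
open import Data.Vec.Functional using (Vector; foldr; _++_)
open import Function.Base using (_∘_)
open import Relation.Binary.PropositionalEquality
open import Relation.Nullary using (Dec; yes; no; ¬_; contradiction)
open import Relation.Nullary.Decidable using (_×-dec_)

sum : ∀ {n} → Vector ℕ n → ℕ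
sum = monoidSum ℕ.+-0-commutativeMonoid

record BidegreeSequence (n : ℕ) : Set where
  field
    a b : Vector ℕ n

  entries : Vector ℕ (n ℕ.+ n)
  entries = a ++ b

  maxDegree : ℕ
  maxDegree = foldr ℕ._⊔_ 0 entries

  -- The start value maxDegree is at least every entry, so for n ≥ 1 it does
  -- not affect the minimum.
  minDegree : ℕ
  minDegree = foldr ℕ._⊓_ maxDegree entries

open BidegreeSequence public

record Graphic {n : ℕ} (d : BidegreeSequence n) : Set where
  field
    matrix   : Fin n → Fin n → Fin 2
    rowSum   : ∀ i → sum (λ j → toℕ (matrix i j)) ≡ a d i
    colSum   : ∀ j → sum (λ i → toℕ (matrix i j)) ≡ b d j
    diagonal : ∀ i → matrix i i ≡ zero

fromℕ : ℕ → ℚ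
fromℕ n = fromℤ (+ n)

-- The inequality p + √r ≤ x between real numbers, for r ≥ 0, written out in
-- rational terms.
_+√_≤_ : ℚ → ℚ → ℚ → Set
p +√ r ≤ x = p ≤ x × r ≤ (x - p) * (x - p)

-- c = ⌈ p + √r ⌉, for r ≥ 0.
record IsCeiling (p r : ℚ) (c : ℤ) : Set where
  field
    upper : p +√ r ≤ fromℤ c
    least : ∀ j → p +√ r ≤ fromℤ j → c ℤ.≤ j

radicand : (n m : ℕ) (c̄ : ℚ) → ℚ
radicand n m c̄ =
  fromℕ (suc m) * fromℕ (suc m) + fromℕ n * (c̄ - fromℕ 2 * fromℕ m)

-- k = ⌈ m + 1 + √radicand ⌉ if the radicand is non-negative, and k = 1
-- otherwise; exactly one such k exists (IsK-unique, IsK-exists).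
data IsK (n m : ℕ) (c̄ : ℚ) : ℤ → Set where
  real    : ∀ {k} → radicand n m c̄ ≥ 0ℚ →
            IsCeiling (fromℕ (suc m)) (radicand n m c̄) k → IsK n m c̄ k
  nonreal : radicand n m c̄ < 0ℚ → IsK n m c̄ (+ 1)

IsK⇒nonZero : ∀ {n m c̄ k} → IsK n m c̄ k → NonZero (fromℤ k)
IsK⇒nonZero {m = m} (real _ isCeil) with IsCeiling.upper isCeil
... | m+1≤k , _ = >-nonZero (<-≤-trans (positive⁻¹ (fromℕ (suc m))) m+1≤k)
IsK⇒nonZero (nonreal _) = _

degreeBound : ∀ (n m : ℕ) (c̄ : ℚ) {k : ℤ} → IsK n m c̄ k → ℤ
degreeBound n m c̄ {k} isK =
  floor (fromℕ n * ((c̄ - fromℕ m) ÷ fromℤ k) + fromℕ m)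
  where instance _ = IsK⇒nonZero isK

private
  <⇒≱ : ∀ {p q} → p < q → ¬ (q ≤ p)
  <⇒≱ p<q q≤p = <-irrefl refl (<-≤-trans p<q q≤p)

IsK-unique : ∀ {n m c̄ k l} → IsK n m c̄ k → IsK n m c̄ l → k ≡ l
IsK-unique (real _ p) (real _ q) = ℤ.≤-antisym
  (IsCeiling.least p _ (IsCeiling.upper q))
  (IsCeiling.least q _ (IsCeiling.upper p))
IsK-unique (real r≥0 _)  (nonreal r<0) = contradiction r≥0 (<⇒≱ r<0)
IsK-unique (nonreal r<0) (real r≥0 _)  = contradiction r≥0 (<⇒≱ r<0)
IsK-unique (nonreal _)   (nonreal _)   = refl

private
  leastℕ : {P : ℕ → Set} → (∀ t → Dec (P t)) → ∀ N → P N →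
           ∃ λ t → P t × (∀ s → P s → t ℕ.≤ s)
  leastℕ P? zero pN = 0 , pN , λ _ _ → z≤n
  leastℕ {P} P? (suc N) pN with P? 0
  ... | yes p₀ = 0 , p₀ , λ _ _ → z≤n
  ... | no ¬p₀ with leastℕ (P? ∘ suc) N pN
  ...   | t , pt , min = suc t , pt , λ where
    zero    p₀ → contradiction p₀ ¬p₀
    (suc s) ps → s≤s (min s ps)

  fromℕ-mono-≤ : ∀ {x y} → x ℕ.≤ y → fromℕ x ≤ fromℕ y
  fromℕ-mono-≤ x≤y = *≤* (ℤ.*-monoʳ-≤-nonNeg (+ 1) (+≤+ x≤y))

  fromℕ-homo-+ : ∀ x y → fromℕ (x ℕ.+ y) ≡ fromℕ x + fromℕ y
  fromℕ-homo-+ x y = sym (trans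
    (cong (_/ 1) (cong₂ ℤ._+_ (ℤ.*-identityʳ (+ x)) (ℤ.*-identityʳ (+ y))))
    (↥p/↧p≡p (fromℕ (x ℕ.+ y))))

  p≤∣↥p∣ : ∀ p → p ≤ fromℕ ℤ.∣ ↥ p ∣
  p≤∣↥p∣ (mkℚ (+ n) d-1 _) =
    *≤* (ℤ.*-monoˡ-≤-nonNeg (+ n) (+≤+ (s≤s z≤n)))
  p≤∣↥p∣ (mkℚ -[1+ n ] d-1 _) = *≤* ℤ.-≤+

  n≤n² : ∀ n → fromℕ n ≤ fromℕ n * fromℕ n
  n≤n² zero    = ≤-refl
  n≤n² (suc n) = ≤-trans (≤-reflexive (sym (*-identityʳ (fromℕ (suc n)))))
    (*-monoˡ-≤-nonNeg (fromℕ (suc n)) (fromℕ-mono-≤ {1} {suc n} (s≤s z≤n)))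

  [p+q]-p≡q : ∀ p q → (p + q) - p ≡ q
  [p+q]-p≡q p q = begin
    (p + q) - p   ≡⟨ cong (_- p) (+-comm p q) ⟩
    (q + p) - p   ≡⟨ +-assoc q p (- p) ⟩
    q + (p - p)   ≡⟨ cong (λ x → q + x) (+-inverseʳ p) ⟩
    q + 0ℚ        ≡⟨ +-identityʳ q ⟩
    q             ∎
    where open ≡-Reasoning

  ≤square : ∀ {r} p q x → x ≡ p + q → r ≤ q * q → r ≤ (x - p) * (x - p)
  ≤square {r} p q _ refl = subst (λ y → r ≤ y * y) (sym ([p+q]-p≡q p q))

IsCeiling-exists : ∀ m r → ∃ (IsCeiling (fromℕ m) r)
IsCeiling-exists m r = isCeiling (leastℕ P? (m ℕ.+ N) bound)
  where
  p = fromℕ m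
  N = ℤ.∣ ↥ r ∣

  P : ℕ → Set
  P t = p +√ r ≤ fromℕ t

  P? : ∀ t → Dec (P t)
  P? t = (p ≤? fromℕ t) ×-dec (r ≤? (fromℕ t - p) * (fromℕ t - p))

  bound : P (m ℕ.+ N)
  bound = fromℕ-mono-≤ (ℕ.m≤m+n m N) ,
    ≤square p (fromℕ N) (fromℕ (m ℕ.+ N)) (fromℕ-homo-+ m N)
            (≤-trans (p≤∣↥p∣ r) (n≤n² N))

  isCeiling : (∃ λ t → P t × (∀ s → P s → t ℕ.≤ s)) → ∃ (IsCeiling p r)
  isCeiling (t , pt , min) = + t , record { upper = pt ; least = least }
    where
    least : ∀ j → p +√ r ≤ fromℤ j → + t ℤ.≤ j
    least (+ s)    ps        = +≤+ (min s ps)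
    least -[1+ s ] (p≤j , _) =
      contradiction (≤-trans (nonNegative⁻¹ p) p≤j)
                    (<⇒≱ (negative⁻¹ (fromℤ -[1+ s ])))

IsK-exists : ∀ n m c̄ → ∃ (IsK n m c̄)
IsK-exists n m c̄ = decide (0ℚ ≤? radicand n m c̄)
  where
  decide : Dec (0ℚ ≤ radicand n m c̄) → ∃ (IsK n m c̄)
  decide (no r≱0)  = + 1 , nonreal (≰⇒> r≱0)
  decide (yes r≥0) =
    map₂ (real r≥0) (IsCeiling-exists (suc m) (radicand n m c̄))

{-# OPTIONS --safe #-}
-- By the Fulkerson–Chen–Anstee theorem, d is graphic if for all index sets I
-- and K, with p = |I| and r = |K|,
--   a(I) + b(K) + |I ∩ K| ≤ Σ a + p r.
-- This criterion is proved by deciding edge by edge: if discarding an edge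
-- violates the cut condition of the remaining problem at (I , J), then
-- uncrossing any other pair (I′ , J′) with (I , J) shows that selecting it is
-- harmless.
--
-- To verify the inequality let m, M be the extreme degrees, S = Σ a, p ≤ r, and
-- bound a(I) by p M and by S − (n − p) m, and b(K) likewise; |I ∩ K| ≤ p.
-- If r > M, the bounds p M and S suffice.  If p, r ≥ k, the two bounds through
-- m reduce it to (k − m − 1)² being at least the radicand.  For p ≤ k ≤ r the
-- bounds p M and S − (n − r) m give an inequality linear in p, worst at p = k.
-- For p ≤ r < k, the bounds p M and r M give one that is worst at p = r, and
-- then at r = min(k, M).  If the radicand is negative, the second argument
-- works for p, r > m, and p ≤ m follows from M ≤ n − 1 alone.
module Submission where

open import Defs

module _ where
  open import Data.Bool.Base using (Bool; true; false; not; _∧_; _∨_)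
  open import Data.Fin.Base using (Fin; zero; suc; fromℕ<; punchIn; _↑ˡ_; _↑ʳ_)
  open import Data.Fin.Properties using (toℕ-fromℕ<; toℕ-injective)
  open import Data.Fin.Subset using (Subset; ⊥; _∪_; _∩_; ∁; ⁅_⁆)
  open import Data.Fin.Subset.Properties using (anySubset?)
  open import Data.List.Base as List using (List; []; _∷_; _++_; concat)
  open import Data.List.Properties using (map-++)
  open import Data.Nat.Base using (ℕ; zero; suc; _+_; _*_; _⊔_; _⊓_; _≤_; _<_; z≤n; s≤s; s≤s⁻¹)
  import Data.Nat.ListAction as ListAction
  open import Data.Nat.ListAction.Properties using (sum-++)
  open import Data.Nat.Properties
  open import Data.Nat.Tactic.RingSolver using (solve-∀)
  open import Data.Product using (_×_; _,_; ∃; proj₁; proj₂)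
  open import Data.Sum.Base using (_⊎_; inj₁; inj₂)
  open import Data.Vec.Base using (lookup)
  open import Data.Vec.Functional using (Vector; foldr)
  open import Data.Vec.Functional.Properties using (lookup-++ˡ; lookup-++ʳ)
  open import Data.Vec.Properties using (lookup-zipWith; lookup-map; lookup-replicate)
  open import Function.Base using (_∘_)
  open import Relation.Binary.PropositionalEquality
  open import Relation.Nullary using (yes; no)
  open import Algebra.Properties.CommutativeSemigroup +-commutativeSemigroup using (interchange)
  open import Algebra.Properties.Semiring.Sum +-*-semiring
    using (*-distribˡ-sum; *-distribʳ-sum; ∑-distrib-+; sum-cong-≗; sum-remove)

  private
    variable
      A : Set
      m n : ℕ

  -- Linear arithmetic: an inequality follows from others once the slack s is
  -- exhibited by a semiring identity without subtraction.
  ≤-certificate : ∀ {x y l r} s → l ≤ r → x + r + s ≡ y + l → x ≤ y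
  ≤-certificate {x} {y} {l} {r} s l≤r eq = +-cancelʳ-≤ r x y (begin
    x + r      ≤⟨ m≤m+n (x + r) s ⟩
    x + r + s  ≡⟨ eq ⟩
    y + l      ≤⟨ +-monoʳ-≤ y l≤r ⟩
    y + r      ∎)
    where open ≤-Reasoning

  -- Sums over vectors and lists.

  sum-mono-≤ : {f g : Vector ℕ n} → (∀ i → f i ≤ g i) → sum f ≤ sum g
  sum-mono-≤ {zero}  f≤g = z≤n
  sum-mono-≤ {suc n} f≤g = +-mono-≤ (f≤g zero) (sum-mono-≤ (f≤g ∘ suc))

  sum-const : ∀ n x → sum {n} (λ _ → x) ≡ n * x
  sum-const zero    x = refl
  sum-const (suc n) x = cong (x +_) (sum-const n x)

  sum≡0 : {f : Vector ℕ n} → (∀ i → f i ≡ 0) → sum f ≡ 0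
  sum≡0 {n} f≡0 = trans (sum-cong-≗ f≡0) (trans (sum-const n 0) (*-zeroʳ n))

  -- A strict inequality in one term would make `sum f` smaller than `sum g`. This turns one-sided
  -- degree bounds into equalities.
  ≤∧sum≥⇒≗ : {f g : Vector ℕ n} → (∀ i → f i ≤ g i) → sum g ≤ sum f → f ≗ g
  ≤∧sum≥⇒≗ {suc n} {f} {g} f≤g Σg≤Σf = λ where
    zero    → ≤-antisym (f≤g zero) (+-cancelʳ-≤ (sum (f ∘ suc)) _ _
                (≤-trans (+-monoʳ-≤ (g zero) (sum-mono-≤ (f≤g ∘ suc))) Σg≤Σf))
    (suc i) → ≤∧sum≥⇒≗ (f≤g ∘ suc) (+-cancelˡ-≤ (f zero) _ _
                (≤-trans (+-monoˡ-≤ (sum (g ∘ suc)) (f≤g zero)) Σg≤Σf)) i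

  total : (A → ℕ) → List A → ℕ
  total φ = ListAction.sum ∘ List.map φ

  total-cong : {φ ψ : A → ℕ} → φ ≗ ψ → total φ ≗ total ψ
  total-cong φ≗ψ []       = refl
  total-cong φ≗ψ (x ∷ xs) = cong₂ _+_ (φ≗ψ x) (total-cong φ≗ψ xs)

  total-mono-≤ : {φ ψ : A → ℕ} → (∀ x → φ x ≤ ψ x) → ∀ xs → total φ xs ≤ total ψ xs
  total-mono-≤ φ≤ψ []       = z≤n
  total-mono-≤ φ≤ψ (x ∷ xs) = +-mono-≤ (φ≤ψ x) (total-mono-≤ φ≤ψ xs)

  total-+ : (φ ψ : A → ℕ) → ∀ xs → total (λ x → φ x + ψ x) xs ≡ total φ xs + total ψ xs
  total-+ φ ψ []       = refl
  total-+ φ ψ (x ∷ xs) = trans (cong (φ x + ψ x +_) (total-+ φ ψ xs))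
    (interchange (φ x) (ψ x) (total φ xs) (total ψ xs))

  total-++ : (φ : A → ℕ) → ∀ xs ys → total φ (xs ++ ys) ≡ total φ xs + total φ ys
  total-++ φ xs ys = trans (cong ListAction.sum (map-++ φ xs ys)) (sum-++ (List.map φ xs) (List.map φ ys))

  total-tabulate : (φ : A → ℕ) (f : Fin n → A) → total φ (List.tabulate f) ≡ sum (φ ∘ f)
  total-tabulate {n = zero}  φ f = refl
  total-tabulate {n = suc n} φ f = cong (φ (f zero) +_) (total-tabulate φ (f ∘ suc))

  total-concat-tabulate : (φ : A → ℕ) (f : Fin n → List A) →
                          total φ (concat (List.tabulate f)) ≡ sum (total φ ∘ f)
  total-concat-tabulate {n = zero}  φ f = refl
  total-concat-tabulate {n = suc n} φ f = trans
    (total-++ φ (f zero) (concat (List.tabulate (f ∘ suc))))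
    (cong (total φ (f zero) +_) (total-concat-tabulate φ (f ∘ suc)))

  sum-total : (φ : Fin n → A → ℕ) → ∀ xs →
              sum (λ i → total (φ i) xs) ≡ total (λ x → sum (λ i → φ i x)) xs
  sum-total {n = n} φ [] = sum≡0 {n} (λ _ → refl)
  sum-total φ (x ∷ xs) = trans (∑-distrib-+ (λ i → φ i x) (λ i → total (φ i) xs))
    (cong (sum (λ i → φ i x) +_) (sum-total φ xs))

  -- Indicators and weights of subsets.

  bit : Bool → ℕ
  bit false = 0
  bit true  = 1

  bit≤1 : ∀ x → bit x ≤ 1
  bit≤1 false = z≤n
  bit≤1 true  = ≤-refl

  bit-∨-∧ : ∀ x y → bit (x ∨ y) + bit (x ∧ y) ≡ bit x + bit y
  bit-∨-∧ false y     = +-identityʳ (bit y)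
  bit-∨-∧ true  false = refl
  bit-∨-∧ true  true  = refl

  bit-not : ∀ x → bit x + bit (not x) ≡ 1
  bit-not false = refl
  bit-not true  = refl

  -- Submodularity of the cut function for a single edge: `x`, `x′` record whether its tail lies in
  -- I, I′, and `y`, `y′` whether its head lies in J, J′.
  bit-submodular : ∀ x x′ y y′ →
    bit (x ∨ x′) * bit (not (y ∨ y′)) + bit (x ∧ x′) * bit (not (y ∧ y′)) ≤
    bit x * bit (not y) + bit x′ * bit (not y′)
  bit-submodular false false y     y′    = z≤n
  bit-submodular false true  false y′    = ≤-reflexive (+-identityʳ _)
  bit-submodular false true  true  y′    = z≤n
  bit-submodular true  false true  y′    = z≤n
  bit-submodular true  false false false = ≤-refl
  bit-submodular true  false false true  = z≤n
  bit-submodular true  true  true  y′    = ≤-refl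
  bit-submodular true  true  false false = ≤-refl
  bit-submodular true  true  false true  = ≤-refl

  -- The two terms exclude each other: an edge with head in J′ does not end outside J ∪ J′.
  bit-∨-crossing : ∀ x y y′ → bit y′ + bit x * bit (not (y ∨ y′)) ≤ 1
  bit-∨-crossing false y     y′    = ≤-trans (≤-reflexive (+-identityʳ (bit y′))) (bit≤1 y′)
  bit-∨-crossing true  true  y′    = ≤-trans (≤-reflexive (+-identityʳ (bit y′))) (bit≤1 y′)
  bit-∨-crossing true  false false = ≤-refl
  bit-∨-crossing true  false true  = ≤-refl

  bit-∧-crossing : ∀ x x′ y → bit (x ∧ x′) * bit (not y) ≤ bit x′
  bit-∧-crossing false x′    y     = z≤n
  bit-∧-crossing true  false y     = z≤n
  bit-∧-crossing true  true  false = ≤-refl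
  bit-∧-crossing true  true  true  = z≤n

  ind : Subset n → Vector ℕ n
  ind I i = bit (lookup I i)

  size : Subset n → ℕ
  size I = sum (ind I)

  weight : Vector ℕ n → Subset n → ℕ
  weight a I = sum (λ i → ind I i * a i)

  ind-∪-∩ : (I J : Subset n) → ∀ i → ind (I ∪ J) i + ind (I ∩ J) i ≡ ind I i + ind J i
  ind-∪-∩ I J i rewrite lookup-zipWith _∨_ i I J | lookup-zipWith _∧_ i I J =
    bit-∨-∧ (lookup I i) (lookup J i)

  ind-∁ : (I : Subset n) → ∀ i → ind I i + ind (∁ I) i ≡ 1
  ind-∁ I i rewrite lookup-map i not I = bit-not (lookup I i)

  weight-∪-∩ : (a : Vector ℕ n) (I J : Subset n) →
               weight a (I ∪ J) + weight a (I ∩ J) ≡ weight a I + weight a J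
  weight-∪-∩ a I J = begin
    weight a (I ∪ J) + weight a (I ∩ J)
      ≡⟨ ∑-distrib-+ (λ i → ind (I ∪ J) i * a i) (λ i → ind (I ∩ J) i * a i) ⟨
    sum (λ i → ind (I ∪ J) i * a i + ind (I ∩ J) i * a i)
      ≡⟨ sum-cong-≗ (λ i → trans (sym (*-distribʳ-+ (a i) (ind (I ∪ J) i) (ind (I ∩ J) i)))
           (trans (cong (_* a i) (ind-∪-∩ I J i)) (*-distribʳ-+ (a i) (ind I i) (ind J i)))) ⟩
    sum (λ i → ind I i * a i + ind J i * a i)
      ≡⟨ ∑-distrib-+ (λ i → ind I i * a i) (λ i → ind J i * a i) ⟩
    weight a I + weight a J ∎
    where open ≡-Reasoning

  weight-∁ : (a : Vector ℕ n) (I : Subset n) → weight a I + weight a (∁ I) ≡ sum a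
  weight-∁ a I = trans (sym (∑-distrib-+ (λ i → ind I i * a i) (λ i → ind (∁ I) i * a i)))
    (sum-cong-≗ (λ i → trans (sym (*-distribʳ-+ (a i) (ind I i) (ind (∁ I) i)))
      (trans (cong (_* a i) (ind-∁ I i)) (*-identityˡ (a i)))))

  ind-⊥ : ∀ (i : Fin n) → ind ⊥ i ≡ 0
  ind-⊥ i = cong bit (lookup-replicate i false)

  weight-⊥ : (a : Vector ℕ n) → weight a ⊥ ≡ 0
  weight-⊥ a = sum≡0 (λ i → cong (_* a i) (ind-⊥ i))

  weight-⁅⁆ : (a : Vector ℕ n) → ∀ i → weight a ⁅ i ⁆ ≡ a i
  weight-⁅⁆ {suc n} a zero    = trans (cong₂ _+_ (+-identityʳ (a zero)) (weight-⊥ (a ∘ suc))) (+-identityʳ (a zero))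
  weight-⁅⁆ {suc n} a (suc i) = weight-⁅⁆ (a ∘ suc) i

  ind-⁅⁆-sym : ∀ (i j : Fin n) → ind ⁅ i ⁆ j ≡ ind ⁅ j ⁆ i
  ind-⁅⁆-sym zero    zero    = refl
  ind-⁅⁆-sym zero    (suc j) = ind-⊥ j
  ind-⁅⁆-sym (suc i) zero    = sym (ind-⊥ i)
  ind-⁅⁆-sym (suc i) (suc j) = ind-⁅⁆-sym i j

  ind-⁅⁆-refl : ∀ (i : Fin n) → ind ⁅ i ⁆ i ≡ 1
  ind-⁅⁆-refl zero    = refl
  ind-⁅⁆-refl (suc i) = ind-⁅⁆-refl i

  size-⁅⁆ : ∀ (i : Fin n) → size ⁅ i ⁆ ≡ 1
  size-⁅⁆ i = trans (sum-cong-≗ (λ j → sym (*-identityʳ (ind ⁅ i ⁆ j)))) (weight-⁅⁆ (λ _ → 1) i)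

  sum-⁅⁆ : ∀ (j : Fin n) → sum (λ i → ind ⁅ i ⁆ j) ≡ 1
  sum-⁅⁆ j = trans (sum-cong-≗ (λ i → ind-⁅⁆-sym i j)) (size-⁅⁆ j)

  -- Edges from rows to columns and their cuts.

  Edge : ℕ → ℕ → Set
  Edge m n = Fin m × Fin n

  leaving : Subset m → Edge m n → ℕ
  leaving I (i , j) = ind I i

  entering : Subset n → Edge m n → ℕ
  entering J (i , j) = ind J j

  crossing : Subset m → Subset n → Edge m n → ℕ
  crossing I J (i , j) = ind I i * ind (∁ J) j

  crossing-submodular : (I I′ : Subset m) (J J′ : Subset n) → ∀ e →
    crossing (I ∪ I′) (J ∪ J′) e + crossing (I ∩ I′) (J ∩ J′) e ≤ crossing I J e + crossing I′ J′ e
  crossing-submodular I I′ J J′ (i , j)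
    rewrite lookup-map j not (J ∪ J′) | lookup-map j not (J ∩ J′) | lookup-map j not J | lookup-map j not J′
          | lookup-zipWith _∨_ i I I′ | lookup-zipWith _∧_ i I I′
          | lookup-zipWith _∨_ j J J′ | lookup-zipWith _∧_ j J J′ =
    bit-submodular (lookup I i) (lookup I′ i) (lookup J j) (lookup J′ j)

  entering+crossing-∪≤1 : (I : Subset m) (J J′ : Subset n) → ∀ e →
    entering J′ e + crossing I (J ∪ J′) e ≤ 1
  entering+crossing-∪≤1 I J J′ (i , j)
    rewrite lookup-map j not (J ∪ J′) | lookup-zipWith _∨_ j J J′ =
    bit-∨-crossing (lookup I i) (lookup J j) (lookup J′ j)

  crossing-∩≤leaving : (I I′ : Subset m) (J : Subset n) → ∀ e → crossing (I ∩ I′) J e ≤ leaving I′ e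
  crossing-∩≤leaving I I′ J (i , j)
    rewrite lookup-map j not J | lookup-zipWith _∧_ i I I′ =
    bit-∧-crossing (lookup I i) (lookup I′ i) (lookup J j)

  total-modular : (φ∪ φ∩ φ ψ : A → ℕ) → (∀ x → φ∪ x + φ∩ x ≡ φ x + ψ x) →
                  ∀ xs → total φ∪ xs + total φ∩ xs ≡ total φ xs + total ψ xs
  total-modular φ∪ φ∩ φ ψ eq xs =
    trans (sym (total-+ φ∪ φ∩ xs)) (trans (total-cong eq xs) (total-+ φ ψ xs))

  total-submodular : (φ∪ φ∩ φ ψ : A → ℕ) → (∀ x → φ∪ x + φ∩ x ≤ φ x + ψ x) →
                     ∀ xs → total φ∪ xs + total φ∩ xs ≤ total φ xs + total ψ xs
  total-submodular φ∪ φ∩ φ ψ le xs =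
    subst₂ _≤_ (total-+ φ∪ φ∩ xs) (total-+ φ ψ xs) (total-mono-≤ le xs)

  -- Selecting edges with prescribed degrees.

  module Selection (a : Vector ℕ m) (b : Vector ℕ n) where

    -- Once `X` is selected, the residual degree sums are a(I) minus the edges of `X` leaving I, and
    -- b(J) minus the edges of `X` entering J. Each subtracted count is moved to the other side of
    -- the cut inequality.
    demand supply : List (Edge m n) → Subset m → Subset n → ℕ
    demand X I J = weight a I + total (entering J) X
    supply X I J = weight b J + total (leaving I) X

    demand-modular : ∀ X I I′ J J′ →
      demand X (I ∪ I′) (J ∪ J′) + demand X (I ∩ I′) (J ∩ J′) ≡ demand X I J + demand X I′ J′
    demand-modular X I I′ J J′ = begin
      demand X (I ∪ I′) (J ∪ J′) + demand X (I ∩ I′) (J ∩ J′)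
        ≡⟨ interchange (weight a (I ∪ I′)) _ (weight a (I ∩ I′)) _ ⟩
      weight a (I ∪ I′) + weight a (I ∩ I′) + (total (entering (J ∪ J′)) X + total (entering (J ∩ J′)) X)
        ≡⟨ cong₂ _+_ (weight-∪-∩ a I I′) (total-modular (entering (J ∪ J′)) (entering (J ∩ J′)) (entering J) (entering J′)
             (λ e → ind-∪-∩ J J′ (proj₂ e)) X) ⟩
      weight a I + weight a I′ + (total (entering J) X + total (entering J′) X)
        ≡⟨ interchange (weight a I) _ _ _ ⟩
      demand X I J + demand X I′ J′ ∎
      where open ≡-Reasoning

    supply-modular : ∀ X I I′ J J′ →
      supply X (I ∪ I′) (J ∪ J′) + supply X (I ∩ I′) (J ∩ J′) ≡ supply X I J + supply X I′ J′
    supply-modular X I I′ J J′ = begin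
      supply X (I ∪ I′) (J ∪ J′) + supply X (I ∩ I′) (J ∩ J′)
        ≡⟨ interchange (weight b (J ∪ J′)) _ (weight b (J ∩ J′)) _ ⟩
      weight b (J ∪ J′) + weight b (J ∩ J′) + (total (leaving (I ∪ I′)) X + total (leaving (I ∩ I′)) X)
        ≡⟨ cong₂ _+_ (weight-∪-∩ b J J′) (total-modular (leaving (I ∪ I′)) (leaving (I ∩ I′)) (leaving I) (leaving I′)
             (λ e → ind-∪-∩ I I′ (proj₁ e)) X) ⟩
      weight b J + weight b J′ + (total (leaving I) X + total (leaving I′) X)
        ≡⟨ interchange (weight b J) _ _ _ ⟩
      supply X I J + supply X I′ J′ ∎
      where open ≡-Reasoning

    -- The cut condition for the residual problem in which the edges X have been
    -- selected and the edges E are still available.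
    Feasible : List (Edge m n) → List (Edge m n) → Set
    Feasible X E = ∀ I J → demand X I J ≤ supply X I J + total (crossing I J) E

    Violated : List (Edge m n) → List (Edge m n) → Subset m → Subset n → Set
    Violated X E I J = supply X I J + total (crossing I J) E < demand X I J

    -- Add feasibility at the union and at the intersection to the violation at (I , J). Modularity
    -- of demand and supply and submodularity of the cut leave the inequality at (I′ , J′) with one
    -- unit to spare, but with the crossing terms of `e` on the right. The spare unit pays for `e`
    -- entering J′ and crossing the union cut, which cannot both happen; its crossing of the
    -- intersection cut is paid for by `e` leaving I′.
    feasible-∷ : ∀ {X e E I J} → Feasible X (e ∷ E) → Violated X E I J → Feasible (e ∷ X) E
    feasible-∷ {X} {e} {E} {I} {J} feasible violated I′ J′ =
      ≤-certificate 0
        (+-mono-≤ (feasible (I ∪ I′) (J ∪ J′)) (+-mono-≤ (feasible (I ∩ I′) (J ∩ J′)) (+-mono-≤ violated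
          (+-mono-≤ cut-submodular
            (+-mono-≤ (entering+crossing-∪≤1 (I ∪ I′) J J′ e) (crossing-∩≤leaving I I′ (J ∩ J′) e))))))
        (trans (gather₁ (weight a I′) (entering J′ e) (total (entering J′) X)
                  (supply X (I ∪ I′) (J ∪ J′)) (crossing (I ∪ I′) (J ∪ J′) e) (cut (I ∪ I′) (J ∪ J′))
                  (supply X (I ∩ I′) (J ∩ J′)) (crossing (I ∩ I′) (J ∩ J′) e) (cut (I ∩ I′) (J ∩ J′))
                  (demand X I J) (cut I J) (cut I′ J′) (leaving I′ e))
          -- Between the two regroupings, modularity exchanges the union and intersection terms for
          -- those of the two given pairs.
          (trans (cong₂ (λ s d → s + d + rest) (supply-modular X I I′ J J′) (sym (demand-modular X I I′ J J′)))
            (gather₂ (weight b J′) (leaving I′ e) (total (leaving I′) X) (cut I′ J′)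
                  (demand X (I ∪ I′) (J ∪ J′)) (demand X (I ∩ I′) (J ∩ J′)) (supply X I J) (cut I J)
                  (cut (I ∪ I′) (J ∪ J′)) (cut (I ∩ I′) (J ∩ J′)) (entering J′ e)
                  (crossing (I ∪ I′) (J ∪ J′) e) (crossing (I ∩ I′) (J ∩ J′) e))))
      where
      cut : Subset m → Subset n → ℕ
      cut I J = total (crossing I J) E

      rest : ℕ
      rest = 1 + (entering J′ e + crossing (I ∪ I′) (J ∪ J′) e + cut (I ∪ I′) (J ∪ J′) +
        crossing (I ∩ I′) (J ∩ J′) e + cut (I ∩ I′) (J ∩ J′) + cut I J + cut I′ J′ + leaving I′ e)

      cut-submodular : cut (I ∪ I′) (J ∪ J′) + cut (I ∩ I′) (J ∩ J′) ≤ cut I J + cut I′ J′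
      cut-submodular = total-submodular
        (crossing (I ∪ I′) (J ∪ J′)) (crossing (I ∩ I′) (J ∩ J′)) (crossing I J) (crossing I′ J′)
        (crossing-submodular I I′ J J′) E

      gather₁ : ∀ w η t p∪ e∪ c∪ p∩ e∩ c∩ d c c′ λ′ →
        w + (η + t) + (p∪ + (e∪ + c∪) + (p∩ + (e∩ + c∩) + (d + (c + c′ + (1 + λ′))))) + 0 ≡
        p∪ + p∩ + (d + (w + t)) + (1 + (η + e∪ + c∪ + e∩ + c∩ + c + c′ + λ′))
      gather₁ = solve-∀

      gather₂ : ∀ w λ′ t c′ d∪ d∩ p c c∪ c∩ η e∪ e∩ →
        p + (w + t) + (d∪ + d∩) + (1 + (η + e∪ + c∪ + e∩ + c∩ + c + c′ + λ′)) ≡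
        w + (λ′ + t) + c′ + (d∪ + (d∩ + (suc (p + c) + (c∪ + c∩ + (η + e∪ + e∩)))))
      gather₂ = solve-∀

    -- An edge is discarded if no pair of sets then violates the cut condition, and selected
    -- otherwise. Bounding the total of every `φ` says that `Y` is a sub-multiset of `X` and `E`
    -- together, with no reference to order.
    select : ∀ E {X} → Feasible X E →
             ∃ λ Y → Feasible Y [] × (∀ φ → total φ Y ≤ total φ X + total φ E)
    select []      {X} feasible = X , feasible , λ φ → m≤m+n (total φ X) 0
    select (e ∷ E) {X} feasible
      with anySubset? (λ I → anySubset? (λ J → supply X I J + total (crossing I J) E <? demand X I J))
    ... | yes (I , J , violated) =
      let Y , Y-feasible , Y≤ = select E {e ∷ X} (feasible-∷ {X} {e} {E} {I} {J} feasible violated)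
      in Y , Y-feasible , λ φ → ≤-trans (Y≤ φ) (≤-reflexive (swap (φ e) (total φ X) (total φ E)))
      where
      swap : ∀ x y z → x + y + z ≡ y + (x + z)
      swap = solve-∀
    ... | no ¬violated =
      let Y , Y-feasible , Y≤ = select E {X} (λ I J → ≮⇒≥ (λ v → ¬violated (I , J , v)))
      in Y , Y-feasible , λ φ → ≤-trans (Y≤ φ) (+-monoʳ-≤ (total φ X) (m≤n+m (total φ E) (φ e)))

    -- With no edge left, feasibility at a singleton and `⊥` bounds out-degrees below by `a` and
    -- in-degrees above by `b`. Both degree sums count the edges of `X`, so they lie between the
    -- equal sums of `a` and `b`, and every bound is attained.
    select-exact : ∀ {X} → sum a ≡ sum b → Feasible X [] →
                   (∀ i → a i ≡ total (leaving ⁅ i ⁆) X) × (∀ j → total (entering ⁅ j ⁆) X ≡ b j)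
    select-exact {X} Σa≡Σb feasible =
      ≤∧sum≥⇒≗ a≤out (≤-trans (≤-reflexive Σout≡Σin) (≤-trans (sum-mono-≤ in≤b) (≤-reflexive (sym Σa≡Σb)))) ,
      ≤∧sum≥⇒≗ in≤b (≤-trans (≤-reflexive (sym Σa≡Σb)) (≤-trans (sum-mono-≤ a≤out) (≤-reflexive Σout≡Σin)))
      where
      a≤out : ∀ i → a i ≤ total (leaving ⁅ i ⁆) X
      a≤out i = begin
        a i                     ≡⟨ weight-⁅⁆ a i ⟨
        weight a ⁅ i ⁆          ≤⟨ m≤m+n _ (total (entering ⊥) X) ⟩
        demand X ⁅ i ⁆ ⊥        ≤⟨ feasible ⁅ i ⁆ ⊥ ⟩
        supply X ⁅ i ⁆ ⊥ + total (crossing {m} {n} ⁅ i ⁆ ⊥) []  ≡⟨ +-identityʳ (supply X ⁅ i ⁆ ⊥) ⟩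
        supply X ⁅ i ⁆ ⊥        ≡⟨ cong (_+ total (leaving ⁅ i ⁆) X) (weight-⊥ b) ⟩
        total (leaving ⁅ i ⁆) X ∎
        where open ≤-Reasoning

      in≤b : ∀ j → total (entering ⁅ j ⁆) X ≤ b j
      in≤b j = begin
        total (entering ⁅ j ⁆) X  ≤⟨ m≤n+m _ (weight a ⊥) ⟩
        demand X ⊥ ⁅ j ⁆          ≤⟨ feasible ⊥ ⁅ j ⁆ ⟩
        supply X ⊥ ⁅ j ⁆ + total (crossing {m} {n} ⊥ ⁅ j ⁆) []  ≡⟨ +-identityʳ (supply X ⊥ ⁅ j ⁆) ⟩
        supply X ⊥ ⁅ j ⁆          ≡⟨ cong (weight b ⁅ j ⁆ +_) (total-zero X) ⟩
        weight b ⁅ j ⁆ + 0        ≡⟨ +-identityʳ _ ⟩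
        weight b ⁅ j ⁆            ≡⟨ weight-⁅⁆ b j ⟩
        b j ∎
        where
        open ≤-Reasoning
        total-zero : ∀ X → total (leaving {m} {n} ⊥) X ≡ 0
        total-zero []            = refl
        total-zero ((i , j) ∷ X) = cong₂ _+_ (ind-⊥ i) (total-zero X)

      Σout≡Σin : sum (λ i → total (leaving {n = n} ⁅ i ⁆) X) ≡ sum (λ j → total (entering {m = m} ⁅ j ⁆) X)
      Σout≡Σin = trans (sum-total (λ i → leaving ⁅ i ⁆) X)
        (trans (total-cong (λ e → trans (sum-⁅⁆ (proj₁ e)) (sym (sum-⁅⁆ (proj₂ e)))) X)
          (sym (sum-total (λ j → entering ⁅ j ⁆) X)))

    exact-selection : ∀ E → sum a ≡ sum b →
      (∀ I J → weight a I ≤ weight b J + total (crossing I J) E) →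
      ∃ λ X → (∀ i → total (leaving ⁅ i ⁆) X ≡ a i) × (∀ j → total (entering ⁅ j ⁆) X ≡ b j) ×
              (∀ φ → total φ X ≤ total φ E)
    exact-selection E Σa≡Σb cut =
      let X , feasible , X≤E = select E {[]} (λ I J → subst₂ _≤_ (sym (+-identityʳ (weight a I)))
            (cong (_+ total (crossing I J) E) (sym (+-identityʳ (weight b J)))) (cut I J))
          out , into = select-exact {X} Σa≡Σb feasible
      in X , sym ∘ out , into , X≤E

  -- From selected edges to a matrix with zero diagonal.

  -- The indicator of the edge (i , j), so that its total over a list counts the copies of that
  -- edge. The product form lets row and column sums factor.
  multiplicity : Fin m → Fin n → Edge m n → ℕ
  multiplicity i j (k , l) = ind ⁅ i ⁆ k * ind ⁅ j ⁆ l

  sum-multiplicityʳ : ∀ (i : Fin m) (e : Edge m n) → sum (λ j → multiplicity i j e) ≡ leaving ⁅ i ⁆ e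
  sum-multiplicityʳ i (k , l) = trans (sym (*-distribˡ-sum (ind ⁅ i ⁆ k) (λ j → ind ⁅ j ⁆ l)))
    (trans (cong (ind ⁅ i ⁆ k *_) (sum-⁅⁆ l)) (*-identityʳ _))

  sum-multiplicityˡ : ∀ (j : Fin n) (e : Edge m n) → sum (λ i → multiplicity i j e) ≡ entering ⁅ j ⁆ e
  sum-multiplicityˡ j (k , l) = trans (sym (*-distribʳ-sum (ind ⁅ j ⁆ l) (λ i → ind ⁅ i ⁆ k)))
    (trans (cong (_* ind ⁅ j ⁆ l) (sum-⁅⁆ k)) (*-identityˡ _))

  -- Each off-diagonal position occurs once, since `punchIn i` enumerates the indices other than
  -- `i`.
  loopless : ∀ n → List (Edge (suc n) (suc n))
  loopless n = concat (List.tabulate λ i → List.tabulate λ j → i , punchIn i j)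

  total-loopless : ∀ (φ : Edge (suc n) (suc n) → ℕ) →
    sum (λ i → φ (i , i)) + total φ (loopless n) ≡ sum (λ i → sum (λ j → φ (i , j)))
  total-loopless {n} φ = begin
    sum (λ i → φ (i , i)) + total φ (loopless n)
      ≡⟨ cong (sum (λ i → φ (i , i)) +_) (total-concat-tabulate φ (λ i → List.tabulate λ j → i , punchIn i j)) ⟩
    sum (λ i → φ (i , i)) + sum (λ i → total φ (List.tabulate λ j → i , punchIn i j))
      ≡⟨ ∑-distrib-+ (λ i → φ (i , i)) (λ i → total φ (List.tabulate λ j → i , punchIn i j)) ⟨
    sum (λ i → φ (i , i) + total φ (List.tabulate λ j → i , punchIn i j))
      ≡⟨ sum-cong-≗ (λ i → trans
           (cong (φ (i , i) +_) (total-tabulate φ (λ j → i , punchIn i j)))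
           (sym (sum-remove {i = i} (λ j → φ (i , j))))) ⟩
    sum (λ i → sum (λ j → φ (i , j))) ∎
    where open ≡-Reasoning

  sum-product : (f : Vector ℕ m) (g : Vector ℕ n) → sum (λ i → sum (λ j → f i * g j)) ≡ sum f * sum g
  sum-product f g = trans (sum-cong-≗ (λ i → sym (*-distribˡ-sum (f i) g))) (sym (*-distribʳ-sum (sum g) f))

  total-multiplicity-loopless : ∀ (i j : Fin (suc n)) →
    sum (λ k → multiplicity i j (k , k)) + total (multiplicity i j) (loopless n) ≡ 1
  total-multiplicity-loopless i j = trans (total-loopless (multiplicity i j))
    (trans (sum-product (ind ⁅ i ⁆) (ind ⁅ j ⁆)) (cong₂ _*_ (size-⁅⁆ i) (size-⁅⁆ j)))

  -- The Fulkerson–Chen–Anstee condition, in the form without ordering.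
  CutCondition : BidegreeSequence n → Set
  CutCondition d = ∀ I K →
    weight (a d) I + weight (b d) K + sum (λ i → ind I i * ind K i) ≤ sum (a d) + size I * size K

  -- Take K to be the complement of J. Of the |I| |K| positions in I × K, exactly |I ∩ K| lie on the
  -- diagonal; cancelling these leaves the number of loopless edges across the cut.
  graphic : (d : BidegreeSequence n) → sum (a d) ≡ sum (b d) → CutCondition d → Graphic d
  graphic {zero}  d Σa≡Σb cut = record
    { matrix = λ () ; rowSum = λ () ; colSum = λ () ; diagonal = λ () }
  graphic {suc n} d Σa≡Σb cut = realize (exact-selection (loopless n) Σa≡Σb λ I J →
    ≤-certificate 0 (cut I (∁ J)) (equation I J))
    where
    open Selection (a d) (b d)

    equation : ∀ I J →
      weight (a d) I + (sum (a d) + size I * size (∁ J)) + 0 ≡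
      weight (b d) J + total (crossing I J) (loopless n) +
        (weight (a d) I + weight (b d) (∁ J) + sum (λ i → ind I i * ind (∁ J) i))
    equation I J = trans
      (cong (λ x → weight (a d) I + x + 0) (cong₂ _+_ (trans Σa≡Σb (sym (weight-∁ (b d) J)))
        (trans (sym (sum-product (ind I) (ind (∁ J)))) (sym (total-loopless (crossing I J))))))
      (rearrange (weight (a d) I) (weight (b d) J) (weight (b d) (∁ J))
        (sum (λ i → ind I i * ind (∁ J) i)) (total (crossing I J) (loopless n)))
      where
      rearrange : ∀ w b b′ s t → w + (b + b′ + (s + t)) + 0 ≡ b + t + (w + b′ + s)
      rearrange = solve-∀

    realize : (∃ λ X → (∀ i → total (leaving ⁅ i ⁆) X ≡ a d i) × (∀ j → total (entering ⁅ j ⁆) X ≡ b d j) ×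
                       (∀ φ → total φ X ≤ total φ (loopless n))) → Graphic d
    realize (X , out , into , X≤) = record
      { matrix   = λ i j → fromℕ< (s≤s (entry≤1 i j))
      ; rowSum   = λ i → trans (sum-cong-≗ (λ j → toℕ-fromℕ< (s≤s (entry≤1 i j))))
          (trans (sum-total (multiplicity i) X) (trans (total-cong (sum-multiplicityʳ i) X) (out i)))
      ; colSum   = λ j → trans (sum-cong-≗ (λ i → toℕ-fromℕ< (s≤s (entry≤1 i j))))
          (trans (sum-total (λ i → multiplicity i j) X) (trans (total-cong (sum-multiplicityˡ j) X) (into j)))
      ; diagonal = λ i → toℕ-injective (trans (toℕ-fromℕ< (s≤s (entry≤1 i i))) (n≤0⇒n≡0 (entry≤0 i)))
      }
      where
      entry≤1 : ∀ i j → total (multiplicity i j) X ≤ 1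
      entry≤1 i j = ≤-trans (X≤ (multiplicity i j))
        (≤-trans (m≤n+m _ _) (≤-reflexive (total-multiplicity-loopless i j)))

      diagonal≡1 : ∀ i → sum (λ k → multiplicity i i (k , k)) ≡ 1
      diagonal≡1 i = trans (weight-⁅⁆ (ind ⁅ i ⁆) i) (ind-⁅⁆-refl i)

      -- The diagonal already accounts for the single occurrence of (i , i) among all positions.
      entry≤0 : ∀ i → total (multiplicity i i) X ≤ 0
      entry≤0 i = ≤-trans (X≤ (multiplicity i i)) (≤-reflexive (+-cancelˡ-≡ 1 _ _
        (trans (cong (_+ total (multiplicity i i) (loopless n)) (sym (diagonal≡1 i))) (total-multiplicity-loopless i i))))

  -- The numerical inequality for sets of sizes p ≤ r.

  -- Here p = m + 1 + u and r = m + 1 + v. Adding the bounds through m and eliminating n m by the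
  -- radicand bound leaves t² ≤ u v + v + m + 1.
  large-large : ∀ {n m S t A B} u v → t ≤ u → u ≤ v →
    suc m * suc m + S ≤ t * t + 2 * (n * m) →
    A + n * m ≤ S + (suc m + u) * m → B + n * m ≤ S + (suc m + v) * m →
    A + B + (suc m + u) ≤ S + (suc m + u) * (suc m + v)
  large-large {n} {m} {S} {t} {A} {B} u v t≤u u≤v hS hA hB =
    ≤-certificate (v + suc m) 
      (+-mono-≤ (+-mono-≤ hA hB) (+-mono-≤ hS (*-mono-≤ t≤u (≤-trans t≤u u≤v))))
      (eq n m S t A B u v)
    where
    eq : ∀ n m S t A B u v →
      A + B + (suc m + u) + (S + (suc m + u) * m + (S + (suc m + v) * m) + (t * t + 2 * (n * m) + u * v)) + (v + suc m) ≡
      S + (suc m + u) * (suc m + v) + (A + n * m + (B + n * m) + (suc m * suc m + S + t * t))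
    eq = solve-∀

  row-below : ∀ {S M p r A B} → M < r → A ≤ p * M → B ≤ S → A + B + p ≤ S + p * r
  row-below {S} {M} {p} {r} {A} {B} M<r hA hB = begin
    A + B + p           ≤⟨ +-monoˡ-≤ p (+-mono-≤ hA hB) ⟩
    p * M + S + p       ≡⟨ eq p M S ⟩
    S + p * suc M       ≤⟨ +-monoʳ-≤ S (*-monoʳ-≤ p M<r) ⟩
    S + p * r           ∎
    where
    open ≤-Reasoning
    eq : ∀ p M S → p * M + S + p ≡ S + p * suc M
    eq = solve-∀

  -- With M = r + x and n = r + z, the bounds p M and S - z m reduce the claim to the first
  -- hypothesis, which is linear in p.
  small-any : ∀ {m S x p r z A B} → p * suc x ≤ z * m →
    A ≤ p * (r + x) → B + (r + z) * m ≤ S + r * m → A + B + p ≤ S + p * r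
  small-any {m} {S} {x} {p} {r} {z} {A} {B} h hA hB =
    ≤-certificate 0 (+-mono-≤ h (+-mono-≤ hA hB)) (eq m S x p r z A B)
    where
    eq : ∀ m S x p r z A B → A + B + p + (z * m + (p * (r + x) + (S + r * m))) + 0 ≡
         S + p * r + (p * suc x + (A + (B + (r + z) * m)))
    eq = solve-∀

  -- The case p = k of the hypothesis of `small-any`. Adding the two assumptions cancels S, and t² -
  -- (m + 1)² = k (t - m - 1) brings out the factor k.
  large-bound : ∀ {m S t x w z} → let k = suc m + t; r = k + w; M = r + x; n = r + z in
    suc m * suc m + S ≤ t * t + 2 * (n * m) → k * M + n * m ≤ S + k * m → k * suc x ≤ z * m
  large-bound {m} {S} {t} {x} {w} {z} hS hM = ≤-certificate (suc m + t + suc t * w)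
    (+-mono-≤ hS hM) (eq m S t x w z)
    where
    eq : ∀ m S t x w z → let k = suc m + t; r = k + w; M = r + x; n = r + z in
      k * suc x + (t * t + 2 * (n * m) + (S + k * m)) + (suc m + t + suc t * w) ≡
      z * m + (suc m * suc m + S + (k * M + n * m))
    eq = solve-∀

  -- With M = r + x, the bounds p M and r M require p (x + 1) + r M ≤ S. The left side grows with p,
  -- and the hypothesis is its value at p = r.
  small-small : ∀ {S x p r A B} → p ≤ r → r * (2 * x + suc r) ≤ S →
    A ≤ p * (r + x) → B ≤ r * (r + x) → A + B + p ≤ S + p * r
  small-small {S} {x} {p} {r} {A} {B} p≤r h hA hB =
    ≤-certificate 0 (+-mono-≤ (+-mono-≤ hA hB) (+-mono-≤ h (*-monoˡ-≤ (suc x) p≤r))) (eq S x p r A B)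
    where
    eq : ∀ S x p r A B → A + B + p + (p * (r + x) + r * (r + x) + (S + r * suc x)) + 0 ≡
         S + p * r + (A + B + (r * (2 * x + suc r) + p * suc x))
    eq = solve-∀

  -- Here M = k - 1 + y. Twice the bound on M plus the radicand bound eliminates n m, and (m + 1)² -
  -- t² = k (m + 1 - t).
  sum-bound : ∀ {n m S t y} → let k = suc m + t; M = m + t + y in
    suc m * suc m + S ≤ t * t + 2 * (n * m) → k * M + n * m ≤ S + k * m → k * (2 * y + k) ≤ S
  sum-bound {n} {m} {S} {t} {y} hS hM = ≤-certificate 0 (+-mono-≤ hS (*-monoʳ-≤ 2 hM)) (eq n m S t y)
    where
    eq : ∀ n m S t y → let k = suc m + t; M = m + t + y in
      k * (2 * y + k) + (t * t + 2 * (n * m) + 2 * (S + k * m)) + 0 ≡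
      S + (suc m * suc m + S + 2 * (k * M + n * m))
    eq = solve-∀

  -- With k = r + 1 + s and M = r + s + y, the left side is f(r) for f(r) = r (2 M + 1 - r), and the
  -- right side is f(k) + k. As k ≤ M + 1, f does not decrease from r to k.
  small-bound-≤ : ∀ r s y → r * (2 * (s + y) + suc r) ≤ (suc r + s) * (2 * y + (suc r + s))
  small-bound-≤ r s y = ≤-certificate (1 + s * s + r + 2 * s + 2 * y * s + 2 * y) z≤n (eq r s y)
    where
    eq : ∀ r s y → r * (2 * (s + y) + suc r) + 0 + (1 + s * s + r + 2 * s + 2 * y * s + 2 * y) ≡
         (suc r + s) * (2 * y + (suc r + s)) + 0
    eq = solve-∀

  -- The left side is at most its value M (M + 1) at r = M. Since k and n are at least M + 1, k (M -
  -- m) + n m ≤ S gives (M + 1) M ≤ S.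
  small-bound-> : ∀ {n m S k r x} → m ≤ r + x → r + x < n → r + x < k →
    k * (r + x) + n * m ≤ S + k * m → r * (2 * x + suc r) ≤ S
  small-bound-> {n} {m} {S} {k} {r} {x} m≤M M<n M<k hM with e , m+e≡M ← m≤n⇒∃[o]m+o≡n m≤M =
    ≤-trans (≤-certificate (x * suc x) z≤n (eq r x)) (≤-certificate 0
      (+-mono-≤ hM (+-mono-≤ (*-monoˡ-≤ e M<k) (*-monoˡ-≤ m M<n)))
      (subst (λ M → suc (r + x) * M + (S + k * m + (k * e + n * m)) + 0 ≡
                    S + (k * M + n * m + (suc (r + x) * e + suc (r + x) * m)))
             m+e≡M (eq′ n m S k e (suc (r + x)))))
    where
    eq : ∀ r x → r * (2 * x + suc r) + 0 + x * suc x ≡ suc (r + x) * (r + x) + 0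
    eq = solve-∀
    eq′ : ∀ n m S k e N → N * (m + e) + (S + k * m + (k * e + n * m)) + 0 ≡
          S + (k * (m + e) + n * m + (N * e + N * m))
    eq′ = solve-∀

  -- n, m, M and S are the length, minimum, maximum and sum.  In the real case
  -- k = suc m + t, with t² bounding the radicand; subtracted terms are moved to
  -- the other side.
  data DegreeCondition (n m M S : ℕ) : Set where
    real    : ∀ t → suc m * suc m + S ≤ t * t + 2 * (n * m) →
              (suc m + t) * M + n * m ≤ S + (suc m + t) * m → DegreeCondition n m M S
    nonreal : suc m * suc m + S ≤ 2 * (n * m) → DegreeCondition n m M S

  -- For an index set of size `p` and weight `A`. The last field is A ≤ S - (n - p) m: the
  -- complement weighs at least (n - p) m.
  record SetBounds (n m M S p A : ℕ) : Set where
    field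
      size≤ : p ≤ n
      ≤S    : A ≤ S
      ≤max  : A ≤ p * M
      ≤min  : A + n * m ≤ S + p * m

  cut-bound : ∀ {n m M S p r A B} → m ≤ M → M < n → DegreeCondition n m M S → p ≤ r →
    SetBounds n m M S p A → SetBounds n m M S r B → A + B + p ≤ S + p * r
  cut-bound {n} {m} {M} {S} {p} {r} {A} {B} m≤M M<n condition p≤r hA hB
    with M <? r
  ... | yes M<r = row-below M<r (SetBounds.≤max hA) (SetBounds.≤S hB)
  ... | no  M≮r
    -- From here on M = r + x and n = r + z.
    with x , refl ← m≤n⇒∃[o]m+o≡n (≮⇒≥ M≮r) | z , refl ← m≤n⇒∃[o]m+o≡n (SetBounds.size≤ hB) = cases condition
    where
    open SetBounds
    x<z : x < z
    x<z = +-cancelˡ-< r x z M<n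

    cases : DegreeCondition n m M S → A + B + p ≤ S + p * r
    cases (nonreal hS) with ≤-<-connex p m
    ... | inj₁ p≤m = small-any {x = x} {z = z} (≤-trans (*-mono-≤ p≤m x<z) (≤-reflexive (*-comm m z)))
                       (≤max hA) (≤min hB)
    ... | inj₂ m<p with u , refl ← m≤n⇒∃[o]m+o≡n m<p | v , refl ← m≤n⇒∃[o]m+o≡n (≤-trans m<p p≤r) =
      -- A radicand of at most 0 is the radicand bound with t = 0.
      large-large {n} {m} {S} {0} {A} {B} u v z≤n (+-cancelˡ-≤ (suc m) u v p≤r) hS (≤min hA) (≤min hB)
    cases (real t hS hM) with ≤-<-connex (suc m + t) r
    ... | inj₂ r<k = small-small {x = x} p≤r bound (≤max hA) (≤max hB)
      where
      bound : r * (2 * x + suc r) ≤ S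
      -- Splitting at k ≤ M + 1 rather than k ≤ M is what makes y = M - (k - 1) a natural number.
      bound with ≤-<-connex (suc m + t) (suc (r + x))
      ... | inj₂ M<k = small-bound-> {n} {m} {S} {suc m + t} {r} {x} m≤M M<n (<⇒≤ M<k) hM
      ... | inj₁ k≤sM with s , eq ← m≤n⇒∃[o]m+o≡n r<k | y , eq′ ← m≤n⇒∃[o]m+o≡n (s≤s⁻¹ k≤sM) =
        begin
          r * (2 * x + suc r)                    ≡⟨ cong (λ x → r * (2 * x + suc r)) x≡s+y ⟩
          r * (2 * (s + y) + suc r)              ≤⟨ small-bound-≤ r s y ⟩
          (suc r + s) * (2 * y + (suc r + s))    ≡⟨ cong (λ k → k * (2 * y + k)) eq ⟩
          (suc m + t) * (2 * y + (suc m + t))    ≤⟨ sum-bound {n} {m} {S} {t} {y} hS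
            (subst (λ M → (suc m + t) * M + n * m ≤ S + (suc m + t) * m) (sym eq′) hM) ⟩
          S                                      ∎
        where
        open ≤-Reasoning
        x≡s+y : x ≡ s + y
        x≡s+y = +-cancelˡ-≡ r x (s + y)
          (trans (sym eq′) (trans (cong (_+ y) (suc-injective (sym eq))) (+-assoc r s y)))
    cases (real t hS hM) | inj₁ k≤r with ≤-<-connex p (suc m + t)
    ... | inj₁ p≤k with w , refl ← m≤n⇒∃[o]m+o≡n k≤r = small-any {x = x} {z = z}
      (≤-trans (*-monoˡ-≤ (suc x) p≤k) (large-bound {x = x} {w} {z} hS hM)) (≤max hA) (≤min hB)
    ... | inj₂ k<p
      with u , refl ← m≤n⇒∃[o]m+o≡n (≤-trans (m≤m+n (suc m) t) (<⇒≤ k<p))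
         | v , refl ← m≤n⇒∃[o]m+o≡n (≤-trans (m≤m+n (suc m) t) k≤r) =
      large-large {n} {m} {S} {t} {A} {B} u v (+-cancelˡ-≤ (suc m) t u (<⇒≤ k<p))
        (+-cancelˡ-≤ (suc m) u v p≤r) hS (≤min hA) (≤min hB)

  -- Degree bounds for index sets.

  lookup≤foldr-⊔ : ∀ z (xs : Vector ℕ n) i → xs i ≤ foldr _⊔_ z xs
  lookup≤foldr-⊔ z xs zero    = m≤m⊔n _ _
  lookup≤foldr-⊔ z xs (suc i) = m≤n⇒m≤o⊔n (xs zero) (lookup≤foldr-⊔ z (xs ∘ suc) i)

  foldr-⊓≤lookup : ∀ z (xs : Vector ℕ n) i → foldr _⊓_ z xs ≤ xs i
  foldr-⊓≤lookup z xs zero    = m⊓n≤m _ _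
  foldr-⊓≤lookup z xs (suc i) = m≤n⇒o⊓m≤n (xs zero) (foldr-⊓≤lookup z (xs ∘ suc) i)

  foldr-⊓≤start : ∀ z (xs : Vector ℕ n) → foldr _⊓_ z xs ≤ z
  foldr-⊓≤start {zero}  z xs = ≤-refl
  foldr-⊓≤start {suc n} z xs = m≤n⇒o⊓m≤n (xs zero) (foldr-⊓≤start z (xs ∘ suc))

  WithinDegrees : BidegreeSequence n → ℕ → Set
  WithinDegrees d x = minDegree d ≤ x × x ≤ maxDegree d

  entries-within : ∀ (d : BidegreeSequence n) i → WithinDegrees d (entries d i)
  entries-within d i = foldr-⊓≤lookup (maxDegree d) (entries d) i , lookup≤foldr-⊔ 0 (entries d) i

  a-within : ∀ (d : BidegreeSequence n) i → WithinDegrees d (a d i)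
  a-within {n} d i = subst (WithinDegrees d) (lookup-++ˡ (a d) (b d) i) (entries-within d (i ↑ˡ n))

  b-within : ∀ (d : BidegreeSequence n) i → WithinDegrees d (b d i)
  b-within {n} d i = subst (WithinDegrees d) (lookup-++ʳ (a d) (b d) i) (entries-within d (n ↑ʳ i))

  setBounds : ∀ {m M} (v : Vector ℕ n) → (∀ i → m ≤ v i × v i ≤ M) → ∀ I →
              SetBounds n m M (sum v) (size I) (weight v I)
  setBounds {n} {m} {M} v within I = record
    { size≤ = ≤-trans (sum-mono-≤ (λ i → bit≤1 (lookup I i)))
                (≤-reflexive (trans (sum-const n 1) (*-identityʳ n)))
    ; ≤S    = ≤-trans (m≤m+n (weight v I) (weight v (∁ I))) (≤-reflexive (weight-∁ v I))
    ; ≤max  = ≤-trans (sum-mono-≤ (λ i → *-monoʳ-≤ (ind I i) (proj₂ (within i))))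
                (≤-reflexive (sym (*-distribʳ-sum M (ind I))))
    ; ≤min  = begin
        weight v I + n * m              ≡⟨ cong (weight v I +_) (sum-const n m) ⟨
        weight v I + sum {n} (λ _ → m)  ≡⟨ ∑-distrib-+ (λ i → ind I i * v i) (λ _ → m) ⟨
        sum (λ i → ind I i * v i + m)   ≤⟨ sum-mono-≤ (λ i → exchange (lookup I i) (proj₁ (within i))) ⟩
        sum (λ i → v i + ind I i * m)   ≡⟨ ∑-distrib-+ v (λ i → ind I i * m) ⟩
        sum v + sum (λ i → ind I i * m) ≡⟨ cong (sum v +_) (*-distribʳ-sum m (ind I)) ⟨
        sum v + size I * m              ∎
    }
    where
    open ≤-Reasoning
    -- The termwise form of the last bound: an equality on `I`, and the lower bound `m` off `I`.
    exchange : ∀ {x y} c → x ≤ y → bit c * y + x ≤ y + bit c * x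
    exchange {x} {y} false x≤y = ≤-trans x≤y (m≤m+n y 0)
    exchange {x} {y} true  x≤y = ≤-reflexive (cong₂ _+_ (+-identityʳ y) (sym (+-identityʳ x)))

  sum-ind*ind≤size : (I K : Subset n) → sum (λ i → ind I i * ind K i) ≤ size I
  sum-ind*ind≤size I K = sum-mono-≤ (λ i → ≤-trans (*-monoʳ-≤ (ind I i) (bit≤1 (lookup K i)))
                                              (≤-reflexive (*-identityʳ (ind I i))))

  -- The intersection is at most the smaller of the two sets, so `a` and `b` exchange roles when `K`
  -- is the smaller one.
  cutCondition : (d : BidegreeSequence n) → sum (a d) ≡ sum (b d) → maxDegree d < n →
    DegreeCondition n (minDegree d) (maxDegree d) (sum (a d)) → CutCondition d
  cutCondition {n} d Σa≡Σb M<n condition I K = cases (≤-total (size I) (size K))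
    where
    open ≤-Reasoning

    -- The fold defining `minDegree` starts at `maxDegree`.
    m≤M : minDegree d ≤ maxDegree d
    m≤M = foldr-⊓≤start (maxDegree d) (entries d)

    aBounds : SetBounds n (minDegree d) (maxDegree d) (sum (a d)) (size I) (weight (a d) I)
    aBounds = setBounds (a d) (a-within d) I

    bBounds : SetBounds n (minDegree d) (maxDegree d) (sum (a d)) (size K) (weight (b d) K)
    bBounds = subst (λ S → SetBounds n (minDegree d) (maxDegree d) S (size K) (weight (b d) K))
      (sym Σa≡Σb) (setBounds (b d) (b-within d) K)

    cases : size I ≤ size K ⊎ size K ≤ size I →
      weight (a d) I + weight (b d) K + sum (λ i → ind I i * ind K i) ≤ sum (a d) + size I * size K
    cases (inj₁ p≤r) = begin
      weight (a d) I + weight (b d) K + sum (λ i → ind I i * ind K i)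
        ≤⟨ +-monoʳ-≤ (weight (a d) I + weight (b d) K) (sum-ind*ind≤size I K) ⟩
      weight (a d) I + weight (b d) K + size I
        ≤⟨ cut-bound m≤M M<n condition p≤r aBounds bBounds ⟩
      sum (a d) + size I * size K ∎
    cases (inj₂ r≤p) = begin
      weight (a d) I + weight (b d) K + sum (λ i → ind I i * ind K i)
        ≡⟨ cong₂ _+_ (+-comm (weight (a d) I) (weight (b d) K))
             (sum-cong-≗ (λ i → *-comm (ind I i) (ind K i))) ⟩
      weight (b d) K + weight (a d) I + sum (λ i → ind K i * ind I i)
        ≤⟨ +-monoʳ-≤ (weight (b d) K + weight (a d) I) (sum-ind*ind≤size K I) ⟩
      weight (b d) K + weight (a d) I + size K
        ≤⟨ cut-bound m≤M M<n condition r≤p bBounds aBounds ⟩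
      sum (a d) + size K * size I
        ≡⟨ cong (sum (a d) +_) (*-comm (size K) (size I)) ⟩
      sum (a d) + size I * size K ∎

module _ where
  open import Data.Integer.Base as ℤ using (ℤ; +_; +≤+)
  import Data.Integer.DivMod as ℤ
  import Data.Integer.Properties as ℤ
  open import Data.Nat.Base as ℕ using (ℕ; suc)
  import Data.Nat.Properties as ℕ
  open import Data.Product using (_,_)
  open import Data.Rational.Base
  open import Data.Rational.Literals using (fromℤ)
  open import Data.Rational.Properties
  open import Data.Rational.Solver
  open import Relation.Binary.PropositionalEquality
  open +-*-Solver

  -- From rational to natural inequalities.

  fromℤ-/1 : ∀ i → i / 1 ≡ fromℤ i
  fromℤ-/1 i = ↥p/↧p≡p (fromℤ i)

  fromℤ-homo-+ : ∀ i j → fromℤ (i ℤ.+ j) ≡ fromℤ i + fromℤ j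
  fromℤ-homo-+ i j = sym (trans
    (cong (_/ 1) (cong₂ ℤ._+_ (ℤ.*-identityʳ i) (ℤ.*-identityʳ j))) (fromℤ-/1 (i ℤ.+ j)))

  fromℤ-homo-* : ∀ i j → fromℤ (i ℤ.* j) ≡ fromℤ i * fromℤ j
  fromℤ-homo-* i j = sym (fromℤ-/1 (i ℤ.* j))

  fromℤ-cancel-≤ : ∀ {i j} → fromℤ i ≤ fromℤ j → i ℤ.≤ j
  fromℤ-cancel-≤ {i} {j} (*≤* i≤j) = subst₂ ℤ._≤_ (ℤ.*-identityʳ i) (ℤ.*-identityʳ j) i≤j

  fromℕ-homo-+ : ∀ m n → fromℕ (m ℕ.+ n) ≡ fromℕ m + fromℕ n
  fromℕ-homo-+ m n = fromℤ-homo-+ (+ m) (+ n)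

  fromℕ-homo-* : ∀ m n → fromℕ (m ℕ.* n) ≡ fromℕ m * fromℕ n
  fromℕ-homo-* m n = trans (cong fromℤ (ℤ.pos-* m n)) (fromℤ-homo-* (+ m) (+ n))

  fromℕ-cancel-≤ : ∀ {m n} → fromℕ m ≤ fromℕ n → m ℕ.≤ n
  fromℕ-cancel-≤ m≤n = ℤ.drop‿+≤+ (fromℤ-cancel-≤ m≤n)

  floor≤ : ∀ p → fromℤ (floor p) ≤ p
  floor≤ p@record{} = *≤* (ℤ.≤-trans (ℤ.[n/d]*d≤n (↥ p) (↧ p)) (ℤ.≤-reflexive (sym (ℤ.*-identityʳ (↥ p)))))

  fromℕ-injective : ∀ {m n} → fromℕ m ≡ fromℕ n → m ≡ n
  fromℕ-injective eq = ℤ.+-injective (cong ↥_ eq)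

  fromℤ-mono-≤ : ∀ {i j} → i ℤ.≤ j → fromℤ i ≤ fromℤ j
  fromℤ-mono-≤ i≤j = *≤* (ℤ.*-monoʳ-≤-nonNeg (+ 1) i≤j)


  radicand-shift : ∀ n m S c̄ → fromℕ S ≡ fromℕ n * c̄ →
    radicand n m c̄ + fromℕ (2 ℕ.* (n ℕ.* m)) ≡ fromℕ (suc m ℕ.* suc m ℕ.+ S)
  radicand-shift n m S c̄ S≡ = begin
    radicand n m c̄ + fromℕ (2 ℕ.* (n ℕ.* m))
      ≡⟨ cong (λ x → radicand n m c̄ + x) (trans (fromℕ-homo-* 2 (n ℕ.* m)) (cong (fromℕ 2 *_) (fromℕ-homo-* n m))) ⟩
    radicand n m c̄ + fromℕ 2 * (fromℕ n * fromℕ m)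
      ≡⟨ solve 4 (λ q n m c → q :* q :+ n :* (c :- con (fromℕ 2) :* m) :+ con (fromℕ 2) :* (n :* m) :=
                              q :* q :+ n :* c) refl (fromℕ (suc m)) (fromℕ n) (fromℕ m) c̄ ⟩
    fromℕ (suc m) * fromℕ (suc m) + fromℕ n * c̄
      ≡⟨ cong₂ _+_ (fromℕ-homo-* (suc m) (suc m)) S≡ ⟨
    fromℕ (suc m ℕ.* suc m) + fromℕ S
      ≡⟨ fromℕ-homo-+ (suc m ℕ.* suc m) S ⟨
    fromℕ (suc m ℕ.* suc m ℕ.+ S) ∎
    where open ≡-Reasoning

  radicand≤⇒ : ∀ n m S c̄ x → fromℕ S ≡ fromℕ n * c̄ → radicand n m c̄ ≤ fromℕ x →
               suc m ℕ.* suc m ℕ.+ S ℕ.≤ x ℕ.+ 2 ℕ.* (n ℕ.* m)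
  radicand≤⇒ n m S c̄ x S≡ r≤x = fromℕ-cancel-≤
    (subst₂ _≤_ (radicand-shift n m S c̄ S≡) (sym (fromℕ-homo-+ x (2 ℕ.* (n ℕ.* m))))
      (+-monoˡ-≤ (fromℕ (2 ℕ.* (n ℕ.* m))) r≤x))

  -- Multiplying by k gives k (M - m) ≤ n (c̄ - m), where n c̄ = S; the subtracted terms then change
  -- sides.
  quotient≥⇒ : ∀ n m M S k c̄ .{{_ : NonZero (fromℕ k)}} → fromℕ S ≡ fromℕ n * c̄ →
    fromℕ M ≤ fromℕ n * ((c̄ - fromℕ m) ÷ fromℕ k) + fromℕ m →
    k ℕ.* M ℕ.+ n ℕ.* m ℕ.≤ S ℕ.+ k ℕ.* m
  quotient≥⇒ n m M S k c̄ S≡ M≤ = fromℕ-cancel-≤ (begin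
    fromℕ (k ℕ.* M ℕ.+ n ℕ.* m)
      ≡⟨ trans (fromℕ-homo-+ (k ℕ.* M) (n ℕ.* m)) (cong₂ _+_ (fromℕ-homo-* k M) (fromℕ-homo-* n m)) ⟩
    k′ * fromℕ M + n′ * m′
      ≤⟨ +-monoˡ-≤ (n′ * m′) (*-monoˡ-≤-nonNeg k′ M≤) ⟩
    k′ * (n′ * ((c̄ - m′) * 1/ k′) + m′) + n′ * m′
      -- The inverse of k is an independent variable for the solver, so its product with k is
      -- isolated here and cancelled next.
      ≡⟨ solve 5 (λ n m k k⁻¹ c → k :* (n :* ((c :- m) :* k⁻¹) :+ m) :+ n :* m :=
                                  n :* (c :- m) :* (k :* k⁻¹) :+ k :* m :+ n :* m) refl n′ m′ k′ (1/ k′) c̄ ⟩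
    n′ * (c̄ - m′) * (k′ * 1/ k′) + k′ * m′ + n′ * m′
      ≡⟨ cong (λ x → n′ * (c̄ - m′) * x + k′ * m′ + n′ * m′) (*-inverseʳ k′) ⟩
    n′ * (c̄ - m′) * 1ℚ + k′ * m′ + n′ * m′
      ≡⟨ solve 4 (λ n m k c → n :* (c :- m) :* con 1ℚ :+ k :* m :+ n :* m := n :* c :+ k :* m)
           refl n′ m′ k′ c̄ ⟩
    n′ * c̄ + k′ * m′
      ≡⟨ trans (fromℕ-homo-+ S (k ℕ.* m)) (cong₂ _+_ S≡ (fromℕ-homo-* k m)) ⟨
    fromℕ (S ℕ.+ k ℕ.* m) ∎)
    where
    open ≤-Reasoning
    n′ = fromℕ n
    m′ = fromℕ m
    k′ = fromℕ k

  fromℕ-∸ : ∀ p t → (fromℕ (p ℕ.+ t) - fromℕ p) ≡ fromℕ t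
  fromℕ-∸ p t = trans (cong (_- fromℕ p) (fromℕ-homo-+ p t))
    (solve 2 (λ p t → p :+ t :- p := t) refl (fromℕ p) (fromℕ t))

  degreeCondition : ∀ {n m M S c̄ k} → fromℕ S ≡ fromℕ n * c̄ → (isK : IsK n m c̄ k) →
    + M ℤ.≤ degreeBound n m c̄ isK → DegreeCondition n m M S
  degreeCondition {n} {m} {M} {S} {c̄} S≡ (nonreal r<0) M≤ =
    nonreal (radicand≤⇒ n m S c̄ 0 S≡ (<⇒≤ r<0))
  degreeCondition {n} {m} {M} {S} {c̄} S≡ isK@(real r≥0 isCeil) M≤
    with p≤k , r≤ ← IsCeiling.upper isCeil
    -- The ceiling is at least m + 1, so k = m + 1 + t with t natural, and the radicand is at most
    -- (k - m - 1)² = t².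
    with +≤+ sm≤k ← fromℤ-cancel-≤ p≤k
    with t , refl ← ℕ.m≤n⇒∃[o]m+o≡n sm≤k =
    real t
      (radicand≤⇒ n m S c̄ (t ℕ.* t) S≡ (≤-trans r≤
        (≤-reflexive (trans (cong (λ x → x * x) (fromℕ-∸ (suc m) t)) (sym (fromℕ-homo-* t t))))))
      (quotient≥⇒ n m M S (suc m ℕ.+ t) c̄ S≡ (≤-trans (fromℤ-mono-≤ M≤)
        (floor≤ (fromℕ n * ((c̄ - fromℕ m) ÷ fromℕ (suc m ℕ.+ t)) + fromℕ m))))

open import Data.Integer.Base as ℤ using (ℤ; +_)
import Data.Integer.Properties as ℤ
open import Data.Nat.Base as ℕ using (ℕ; NonZero; _∸_)
import Data.Nat.Properties as ℕ
open import Data.Rational.Base using (ℚ; _*_)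
open import Relation.Binary.PropositionalEquality using (_≡_; sym; trans)

theorem6 : ∀ {n : ℕ} .{{_ : NonZero n}} (d : BidegreeSequence n) (c̄ : ℚ) →
    fromℕ (sum (a d)) ≡ fromℕ n * c̄ →
    fromℕ (sum (b d)) ≡ fromℕ n * c̄ →
    minDegree d ℕ.≤ n ∸ 1 →
    (k : ℤ) (isK : IsK n (minDegree d) c̄ k) →
    + maxDegree d ℤ.≤ degreeBound n (minDegree d) c̄ isK ℤ.⊓ + (n ∸ 1) →
    Graphic d
theorem6 {n} d c̄ Σa≡ Σb≡ _ k isK M≤ = graphic d Σa≡Σb
  (cutCondition d Σa≡Σb
    (ℕ.m≤pred[n]⇒suc[m]≤n (ℤ.drop‿+≤+ (ℤ.≤-trans M≤ (ℤ.i⊓j≤j bound (+ (n ∸ 1))))))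
    (degreeCondition Σa≡ isK (ℤ.≤-trans M≤ (ℤ.i⊓j≤i bound (+ (n ∸ 1))))))
  where
  bound : ℤ
  bound = degreeBound n (minDegree d) c̄ isK

  Σa≡Σb : sum (a d) ≡ sum (b d)
  Σa≡Σb = fromℕ-injective (trans Σa≡ (sym Σb≡))
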